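{- Let $n \in \mathbb{N}^*$ be an integer that is not a prime power, and let $S$ be a zero-sumfree sequence in the cyclic group $C_n$ with $\mathsf{k}(S) \geq \mathsf{k}^*(C_n)$. Then $|S| \leq \lfloor n/2 \rfloor$.
   Context: A sequence in a finite abelian group $G$ (written additively) is a finite list $S=(g_1,\dots,g_\ell)$ of elements of $G$ (repetitions allowed), of length $|S|=\ell$. $S$ is zero-sumfree if $\sum_{i\in I} g_i \neq 0$ for every non-empty $I \subseteq \{1,\dots,\ell\}$. The cross number of $S$ is $\mathsf{k}(S)=\sum_{i=1}^{\ell} \frac{1}{\mathrm{ord}(g_i)}$. For a finite abelian group $G \simeq C_{\nu_1}\oplus\dots\oplus C_{\nu_s}$ written as a direct sum of cyclic groups of prime power orders $\nu_i>1$ (the longest possible such decomposition), $\mathsf{k}^*(G)=\sum_{i=1}^s \frac{\nu_i-1}{\nu_i}$; thus $\mathsf{k}^*(C_n)=\sum_{p^a \| n} \frac{p^a-1}{p^a}$, the sum over the prime powers $p^a$ exactly dividing $n$. -}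

module Defs where

open import Data.Nat as ℕ using (ℕ; zero; suc; _+_; _*_; _^_)
open import Data.Nat.Divisibility using (_∣_; _∣?_)
open import Data.Nat.DivMod using (_/_)
open import Data.Nat.GCD using (gcd)
open import Data.Nat.Primality using (Prime; prime?)
open import Data.Fin using (Fin; toℕ)
open import Data.Fin.Subset using (Subset; Nonempty; inside; outside)
open import Data.Vec using (Vec; []; _∷_; toList)
open import Data.List using (List; upTo; filter; map; foldr)
open import Data.Integer using (+_)
open import Data.Rational as ℚ using (ℚ; 0ℚ; 1ℚ)
open import Data.Product using (Σ; _×_)
open import Relation.Nullary using (¬_; yes; no)
open import Relation.Binary.PropositionalEquality using (_≡_)

-- The cyclic group C_n is modelled as Fin n with addition modulo n;
-- an element g is represented by toℕ g ∈ {0,…,n-1}.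

-- Reciprocal of a natural number as a rational (1/0 := 0, never used for orders).
recip : ℕ → ℚ
recip zero    = 0ℚ
recip (suc k) = (+ 1) ℚ./ suc k

ord : {n : ℕ} → Fin n → ℕ
ord {n} g with gcd (toℕ g) n
... | zero  = 0
... | suc d = n / suc d

subSum : {n ℓ : ℕ} → Vec (Fin n) ℓ → Subset ℓ → ℕ
subSum []       []             = 0
subSum (g ∷ S)  (inside  ∷ I)  = toℕ g + subSum S I
subSum (g ∷ S)  (outside ∷ I)  = subSum S I

ZeroSumFree : {n ℓ : ℕ} → Vec (Fin n) ℓ → Set
ZeroSumFree {n} {ℓ} S = (I : Subset ℓ) → Nonempty I → ¬ (n ∣ subSum S I)

crossNumber : {n ℓ : ℕ} → Vec (Fin n) ℓ → ℚ
crossNumber []      = 0ℚ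
crossNumber (g ∷ S) = recip (ord g) ℚ.+ crossNumber S

-- Largest power of p dividing m (fuel-bounded; fuel m suffices for m ≥ 1, p ≥ 2).
ppartAux : ℕ → ℕ → ℕ → ℕ
ppartAux zero     m p = 1
ppartAux (suc f)  m zero = 1
ppartAux (suc f)  m (suc q) with suc q ∣? m
... | yes _ = suc q * ppartAux f (m / suc q) (suc q)
... | no  _ = 1

ppart : ℕ → ℕ → ℕ
ppart m p = ppartAux m m p

-- Primes dividing n (all such primes are ≤ n when n ≥ 1).
primeDivisors : ℕ → List ℕ
primeDivisors n = filter (λ p → prime? p) (filter (λ p → p ∣? n) (upTo (suc n)))

-- k*(C_n) = Σ_{p^a ∥ n} (p^a - 1)/p^a = Σ_{p ∣ n prime} (1 - 1/ppart n p).
kStar : ℕ → ℚ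
kStar n = foldr ℚ._+_ 0ℚ (map (λ p → 1ℚ ℚ.- recip (ppart n p)) (primeDivisors n))

IsPrimePower : ℕ → Set
IsPrimePower n = Σ ℕ λ p → Σ ℕ λ a → Prime p × (n ≡ p ^ suc a)

{-# OPTIONS --safe #-}
module Submission where

-- Suppose ℓ > n/2.  The set X(S) of subset sums of S, with the empty sum 0, has at
-- most n < 2ℓ elements.  By induction on ℓ, this forces S = (x₁g, …, xₗg) with
-- 1 ≤ xᵢ and s = Σ xᵢ smaller than the order of g (Savchev–Chen): if |X(S∖c)| < 2(ℓ-1)
-- for some term c, then S∖c has this form, and c + X(S∖c) meets X(S∖c), for otherwise
-- |X(S)| = 2|X(S∖c)| ≥ 2ℓ; so c is a multiple of g as well.  Otherwise every
-- X(S∖c) is X(S) without the sum of S, hence independent of c, and all terms agree.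
-- Since s ≥ ℓ > n/2, g is a generator, so gcd(xᵢg, n) ≤ xᵢ and k(S) ≤ s/n < 1, whereas
-- k*(Cₙ) ≥ 1/2 + 1/2 as n has two prime divisors.
--
-- Cardinality bounds are stated negatively, by AtLeast, and case distinctions on them
-- are made under double negation, which is harmless as the final goal is decidable.

open import Defs
open import Data.Nat using (ℕ; NonZero; _≤_)
open import Data.Nat.DivMod using (_/_)
open import Data.Fin using (Fin)
open import Data.Vec using (Vec)
open import Data.Rational using (_≤_)
open import Relation.Nullary using (¬_)

open import Algebra.Bundles using (AbelianGroup)
open import Algebra.Properties.CommutativeSemigroup using (x∙yz≈y∙xz)
open import Algebra.Properties.Group using (∙-cancelˡ; ∙-cancelʳ)
import Algebra.Properties.Monoid.Mult as Mult
open import Data.Nat as ℕ using (_^_)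
import Data.Nat.Properties as ℕ
open import Data.List using (List; []; _∷_; _++_; map; length; foldr; lookup)
open import Data.List.Properties using (length-++; length-map)
open import Data.List.Membership.Propositional using (_∈_; find)
open import Data.List.Membership.Propositional.Properties
  using (∈-∃++; ∈-lookup; ∈-filter⁺; ∈-upTo⁺)
open import Data.List.Relation.Binary.Permutation.Propositional as Perm using (_↭_; ↭-sym)
open import Data.List.Relation.Binary.Permutation.Propositional.Properties using (shift; ↭-length)
open import Data.List.Relation.Unary.All as All using (All; []; _∷_)
import Data.List.Relation.Unary.All.Properties as All
open import Data.List.Relation.Unary.Any using (here; there)
open import Data.List.Relation.Unary.AllPairs as AllPairs using (AllPairs; []; _∷_)
import Data.List.Relation.Unary.AllPairs.Properties as AllPairs
open import Data.Product using (∃-syntax; _×_; _,_; proj₁; proj₂)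
open import Data.Fin as Fin using (toℕ)
open import Data.Fin.Properties using (pigeonhole; fromℕ<-injective)
open import Data.Fin.Subset using (inside; outside) renaming (⊤ to ⊤ₛ)
open import Data.Integer as ℤ using (+_)
import Data.Integer.Properties as ℤ
open import Data.Integer.Tactic.RingSolver using (solve-∀)
open import Data.Nat.Coprimality using (Coprime; coprime-divisor; gcd≡1⇒coprime)
open import Data.Nat.Divisibility
  using ( _∣_; _∣?_; _∣0; 1∣_; m∣m*n; ∣⇒≤; ∣-trans; *-monoʳ-∣
        ; m%n≡0⇒n∣m; n∣m⇒m%n≡0; ∣n∣m%n⇒∣m; %-presˡ-∣)
open import Data.Nat.DivMod
  using ( _%_; _mod_; m%n<n; m≡m%n+[m/n]*n; %-congˡ; %-distribˡ-+; %-distribˡ-*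
        ; m/n*n≡m; m≥n⇒m/n>0)
open import Data.Nat.GCD using (gcd; gcd[m,n]∣m; gcd[m,n]∣n; gcd[m,n]≡0⇒n≡0)
open import Data.Nat.ListAction using (product)
open import Data.Nat.ListAction.Properties using (∈⇒∣product)
open import Data.Nat.Primality using (Prime; prime?; ¬prime[0]; prime⇒nonTrivial)
open import Data.Nat.Primality.Factorisation using (factorise)
open import Data.Rational as ℚ using (ℚ; 0ℚ; 1ℚ)
import Data.Rational.Properties as ℚ
open import Data.Rational.Unnormalised as ℚᵘ using (mkℚᵘ)
import Data.Rational.Unnormalised.Properties as ℚᵘ
open import Data.Vec using ([]; _∷_; toList; here; there)
open import Data.Vec.Properties using (length-toList)
open import Data.Unit.Polymorphic using (⊤; tt)
open import Function using (_∘_; _on_)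
open import Level using (_⊔_; 0ℓ)
import Relation.Binary.Construct.On as On
open import Relation.Binary.Definitions using (Decidable)
open import Relation.Binary.PropositionalEquality as ≡ using (_≡_; _≢_)
open import Relation.Nullary using (yes; no; contradiction)
open import Relation.Nullary.Decidable using (decidable-stable)

∈⇒↭∷ : ∀ {a} {A : Set a} {x : A} {xs} → x ∈ xs → ∃[ ys ] xs ↭ x ∷ ys
∈⇒↭∷ {x = x} x∈xs with ys , zs , ≡.refl ← ∈-∃++ x∈xs = ys ++ zs , shift x ys zs

-- Sequences and their subset sums in an abelian group.

module ZeroSumFreeSequences {c ℓ} (G : AbelianGroup c ℓ) where

  open AbelianGroup G renaming (Carrier to A)
  open Mult monoid renaming (_×_ to _·_)
  open import Relation.Binary.Reasoning.Setoid setoid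

  private
    cancelˡ = ∙-cancelˡ group
    cancelʳ = ∙-cancelʳ group
    x∙y∙z≈y∙x∙z = x∙yz≈y∙xz commutativeSemigroup

    variable
      g a b x y : A
      S S′ T : List A
      w : ℕ

  total : List A → A
  total = foldr _∙_ ε

  data SubsetSum : List A → A → Set (c ⊔ ℓ) where
    empty : x ≈ ε → SubsetSum [] x
    skip  : SubsetSum S x → SubsetSum (a ∷ S) x
    take  : SubsetSum S y → a ∙ y ≈ x → SubsetSum (a ∷ S) x

  -- Recursion on the first selected term: a non-empty selection starts at some `a` and continues
  -- with a possibly empty selection from the tail.
  ZeroFree : List A → Set (c ⊔ ℓ)
  ZeroFree []      = ⊤
  ZeroFree (a ∷ S) = (∀ {x} → SubsetSum S x → a ∙ x ≉ ε) × ZeroFree S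

  data Multiples (g : A) : List A → ℕ → Set (c ⊔ ℓ) where
    []   : Multiples g [] 0
    cons : ∀ {x} → 1 ℕ.≤ x → a ≈ x · g → Multiples g S w → Multiples g (a ∷ S) (x ℕ.+ w)

  -- `multiples` places every subset sum among the multiples `j · base` with `j ≤ weight`, `covers`
  -- makes each of these a subset sum, and `nonzero` makes them distinct. So the set of subset sums
  -- is an arithmetic progression of `weight + 1` elements.
  record Progression (S : List A) : Set (c ⊔ ℓ) where
    field
      base      : A
      weight    : ℕ
      multiples : Multiples base S weight
      nonzero   : ∀ {j} → 1 ℕ.≤ j → j ℕ.≤ weight → j · base ≉ ε
      covers    : ∀ {j} → j ℕ.≤ weight → SubsetSum S (j · base)

  AtLeast : ∀ {p} → ℕ → (A → Set p) → Set (c ⊔ ℓ ⊔ p)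
  AtLeast k P = ∃[ xs ] length xs ≡ k × AllPairs _≉_ xs × All P xs

  SubsetSum-resp : x ≈ y → SubsetSum S x → SubsetSum S y
  SubsetSum-resp x≈y (empty x≈ε)   = empty (trans (sym x≈y) x≈ε)
  SubsetSum-resp x≈y (skip s)      = skip (SubsetSum-resp x≈y s)
  SubsetSum-resp x≈y (take s az≈x) = take s (trans az≈x x≈y)

  SubsetSum-ε : ∀ S → SubsetSum S ε
  SubsetSum-ε []      = empty refl
  SubsetSum-ε (a ∷ S) = skip (SubsetSum-ε S)

  SubsetSum-total : ∀ S → SubsetSum S (total S)
  SubsetSum-total []      = empty refl
  SubsetSum-total (a ∷ S) = take (SubsetSum-total S) refl

  SubsetSum-↭ : S ↭ S′ → SubsetSum S x → SubsetSum S′ x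
  SubsetSum-↭ Perm.refl s = s
  SubsetSum-↭ (Perm.prep a p) (skip s)   = skip (SubsetSum-↭ p s)
  SubsetSum-↭ (Perm.prep a p) (take s e) = take (SubsetSum-↭ p s) e
  SubsetSum-↭ (Perm.swap a b p) (skip (skip s))   = skip (skip (SubsetSum-↭ p s))
  SubsetSum-↭ (Perm.swap a b p) (skip (take s e)) = take (skip (SubsetSum-↭ p s)) e
  SubsetSum-↭ (Perm.swap a b p) (take (skip s) e) = skip (take (SubsetSum-↭ p s) e)
  SubsetSum-↭ (Perm.swap a b p) (take (take s e) e′) =
    take (take (SubsetSum-↭ p s) refl)
         (trans (x∙y∙z≈y∙x∙z b a _) (trans (∙-congˡ e) e′))
  SubsetSum-↭ (Perm.trans p q) s = SubsetSum-↭ q (SubsetSum-↭ p s)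

  ZeroFree-↭ : S ↭ S′ → ZeroFree S → ZeroFree S′
  ZeroFree-↭ Perm.refl zf = zf
  ZeroFree-↭ (Perm.prep a p) (za , zf) =
    za ∘ SubsetSum-↭ (↭-sym p) , ZeroFree-↭ p zf
  ZeroFree-↭ (Perm.swap a b p) (za , zb , zf) =
    (λ { (skip s)   → zb (SubsetSum-↭ (↭-sym p) s)
       ; (take s e) → λ be≈ε → za (take (SubsetSum-↭ (↭-sym p) s) refl)
                        (trans (x∙y∙z≈y∙x∙z a b _) (trans (∙-congˡ e) be≈ε)) }) ,
    za ∘ skip ∘ SubsetSum-↭ (↭-sym p) , ZeroFree-↭ p zf
  ZeroFree-↭ (Perm.trans p q) = ZeroFree-↭ q ∘ ZeroFree-↭ p

  Multiples-↭ : S ↭ S′ → Multiples g S w → Multiples g S′ w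
  Multiples-↭ Perm.refl m = m
  Multiples-↭ (Perm.prep a p) (cons 1≤x e m) = cons 1≤x e (Multiples-↭ p m)
  Multiples-↭ {g = g} (Perm.swap a b p) (cons {x = x} 1≤x e (cons {w = s} {x = y} 1≤y e′ m)) =
    ≡.subst (Multiples g _) y+x+s≡x+y+s (cons 1≤y e′ (cons 1≤x e (Multiples-↭ p m)))
    where
    y+x+s≡x+y+s : y ℕ.+ (x ℕ.+ s) ≡ x ℕ.+ (y ℕ.+ s)
    y+x+s≡x+y+s = x∙yz≈y∙xz ℕ.+-commutativeSemigroup y x s
  Multiples-↭ (Perm.trans p q) = Multiples-↭ q ∘ Multiples-↭ p

  Progression-↭ : S ↭ S′ → Progression S → Progression S′
  Progression-↭ p prog = record
    { multiples = Multiples-↭ p multiples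
    ; nonzero   = nonzero
    ; covers    = SubsetSum-↭ p ∘ covers
    } where open Progression prog

  length≤weight : Multiples g S w → length S ℕ.≤ w
  length≤weight []             = ℕ.z≤n
  length≤weight (cons 1≤x _ m) = ℕ.+-mono-≤ 1≤x (length≤weight m)

  SubsetSum-multiple : Multiples g S w → SubsetSum S x → ∃[ j ] j ℕ.≤ w × x ≈ j · g
  SubsetSum-multiple [] (empty x≈ε) = 0 , ℕ.z≤n , x≈ε
  SubsetSum-multiple (cons _ _ m) (skip t) with j , j≤s , x≈jg ← SubsetSum-multiple m t =
    j , ℕ.m≤n⇒m≤o+n _ j≤s , x≈jg
  SubsetSum-multiple {g = g} (cons {x = k} _ a≈kg m) (take t e)
    with j , j≤s , y≈jg ← SubsetSum-multiple m t =
    k ℕ.+ j , ℕ.+-monoʳ-≤ k j≤s ,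
    trans (sym e) (trans (∙-cong a≈kg y≈jg) (sym (×-homo-+ g k j)))

  -- Select exactly the other terms. This is the symmetry x ↦ σ - x of the set of subset sums, where
  -- σ is the total.
  complement : SubsetSum S x → ∃[ y ] SubsetSum S y × x ∙ y ≈ total S
  complement (empty x≈ε) = ε , empty refl , trans (identityʳ _) x≈ε
  complement {S = a ∷ _} (skip s) with y , t , e ← complement s =
    a ∙ y , take t refl , trans (x∙y∙z≈y∙x∙z _ a y) (∙-congˡ e)
  complement (take s e) with y , t , e′ ← complement s =
    y , skip t , trans (∙-congʳ (sym e)) (trans (assoc _ _ _) (∙-congˡ e′))

  -- If some terms of `S` added up to `a ∙ total S`, the remaining terms of `S` would have sum -a.
  total∉ : ZeroFree (a ∷ S) → ¬ SubsetSum S (total (a ∷ S))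
  total∉ {a} {S} (za , _) s with y , t , e ← complement s = za t (cancelˡ (total S) _ _ (begin
    total S ∙ (a ∙ y)  ≈⟨ assoc _ _ _ ⟨
    total S ∙ a ∙ y    ≈⟨ ∙-congʳ (comm _ _) ⟩
    a ∙ total S ∙ y    ≈⟨ e ⟩
    total S            ≈⟨ identityʳ _ ⟨
    total S ∙ ε        ∎))

  -- Lower bounds for the number of subset sums.

  AtLeast-map : ∀ {p q} {P : A → Set p} {Q : A → Set q} {k} → (∀ {x} → P x → Q x) →
                AtLeast k P → AtLeast k Q
  AtLeast-map P⇒Q (xs , len , distinct , all) = xs , len , distinct , All.map P⇒Q all

  AtLeast-suc : ∀ {p q} {P : A → Set p} {Q : A → Set q} {k} → (∀ {x} → P x → Q x) →
                (∀ {x y} → x ≈ y → P x → P y) → Q a → ¬ P a → AtLeast k P → AtLeast (ℕ.suc k) Q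
  AtLeast-suc {a = a} P⇒Q resp qa ¬pa (xs , len , distinct , all) =
    a ∷ xs , ≡.cong ℕ.suc len ,
    All.map (λ px a≈x → ¬pa (resp (sym a≈x) px)) all ∷ distinct ,
    qa ∷ All.map P⇒Q all

  -- Each further term contributes at least one new sum, namely the new total.
  length<∣SubsetSums∣ : ∀ S → ZeroFree S → AtLeast (ℕ.suc (length S)) (SubsetSum S)
  length<∣SubsetSums∣ []      _  = ε ∷ [] , ≡.refl , [] ∷ [] , empty refl ∷ []
  length<∣SubsetSums∣ (a ∷ S) zf =
    AtLeast-suc skip SubsetSum-resp (SubsetSum-total (a ∷ S)) (total∉ zf) (length<∣SubsetSums∣ S (proj₂ zf))

  -- The sums of `a ∷ S` are those of `S` and their translates by `a`; translation preserves
  -- distinctness, so disjointness doubles the count.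
  disjoint-translate : ∀ k → (∀ {x y} → SubsetSum S x → SubsetSum S y → a ∙ x ≉ y) →
                       AtLeast k (SubsetSum S) → AtLeast (k ℕ.+ k) (SubsetSum (a ∷ S))
  disjoint-translate {a = a} k disjoint (xs , len , distinct , all) =
    xs ++ map (a ∙_) xs ,
    ≡.trans (length-++ xs) (≡.cong₂ ℕ._+_ len (≡.trans (length-map (a ∙_) xs) len)) ,
    AllPairs.++⁺ distinct (AllPairs.map⁺ (AllPairs.map (λ x≉y → x≉y ∘ cancelˡ a _ _) distinct))
      (All.map (λ s → All.map⁺ (All.map (λ t x≈ay → disjoint t s (sym x≈ay)) all)) all) ,
    All.++⁺ (All.map skip all) (All.map⁺ (All.map (λ s → take s refl) all))

  -- Adding a term to a progression.

  -- The bound `k ≤ 1 + s` leaves no gap between 0, ..., s and k, ..., k + s. A multiple beyond s is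
  -- therefore `a` plus an old subset sum, hence a subset sum itself, and nonzero because `a ∷ S` is
  -- zero-free.
  extend : (P : Progression S) → ∀ {k} → 1 ℕ.≤ k → k ℕ.≤ ℕ.suc (Progression.weight P) →
           a ≈ k · Progression.base P → ZeroFree (a ∷ S) → Progression (a ∷ S)
  extend {S} {a} P {k} 1≤k k≤1+s a≈kg (za , _) = record
    { multiples = cons 1≤k a≈kg multiples
    ; nonzero   = nonzero′
    ; covers    = covers′
    }
    where
    open Progression P renaming (base to h; weight to s)

    -- Here `k ≤ 1 + s ≤ j`, so the truncated subtraction `j ∸ k` is exact.
    split : ∀ {j} → s ℕ.< j → j ℕ.≤ k ℕ.+ s → ∃[ i ] i ℕ.≤ s × a ∙ i · h ≈ j · h
    split {j} s<j j≤k+s = j ℕ.∸ k , ℕ.m≤n+o⇒m∸n≤o j k j≤k+s , (begin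
      a ∙ (j ℕ.∸ k) · h      ≈⟨ ∙-congʳ a≈kg ⟩
      k · h ∙ (j ℕ.∸ k) · h  ≈⟨ ×-homo-+ h k (j ℕ.∸ k) ⟨
      (k ℕ.+ (j ℕ.∸ k)) · h  ≡⟨ ≡.cong (_· h) (ℕ.m+[n∸m]≡n (ℕ.≤-trans k≤1+s s<j)) ⟩
      j · h                  ∎)

    nonzero′ : ∀ {j} → 1 ℕ.≤ j → j ℕ.≤ k ℕ.+ s → j · h ≉ ε
    nonzero′ {j} 1≤j j≤k+s with j ℕ.≤? s
    ... | yes j≤s = nonzero 1≤j j≤s
    ... | no  j≰s with i , i≤s , e ← split (ℕ.≰⇒> j≰s) j≤k+s =
      λ jg≈ε → za (covers i≤s) (trans e jg≈ε)

    covers′ : ∀ {j} → j ℕ.≤ k ℕ.+ s → SubsetSum (a ∷ S) (j · h)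
    covers′ {j} j≤k+s with j ℕ.≤? s
    ... | yes j≤s = skip (covers j≤s)
    ... | no  j≰s with i , i≤s , e ← split (ℕ.≰⇒> j≰s) j≤k+s = take (covers i≤s) e

  -- Writing x = ig and y = jg, the overlap says a + ig = jg. If j ≤ i, then (i - j)g is a subset
  -- sum of `S` equal to -a, which is impossible; otherwise a = (j - i)g with 1 ≤ j - i ≤ s, and
  -- `extend` applies.
  extend-overlap : Progression S → ZeroFree (a ∷ S) → SubsetSum S x → SubsetSum S y → a ∙ x ≈ y →
                   Progression (a ∷ S)
  extend-overlap {a = a} P zf s t ax≈y
    with i , i≤s , x≈ig ← SubsetSum-multiple (Progression.multiples P) s
    with j , j≤s , y≈jg ← SubsetSum-multiple (Progression.multiples P) t
    with j ℕ.≤? i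
  ... | yes j≤i = contradiction a∙[i∸j]g≈ε (proj₁ zf (covers (ℕ.≤-trans (ℕ.m∸n≤m i j) i≤s)))
    where
    open Progression P renaming (base to h)
    a∙[i∸j]g≈ε : a ∙ (i ℕ.∸ j) · h ≈ ε
    a∙[i∸j]g≈ε = cancelʳ (j · h) _ _ (begin
      a ∙ (i ℕ.∸ j) · h ∙ j · h    ≈⟨ assoc _ _ _ ⟩
      a ∙ ((i ℕ.∸ j) · h ∙ j · h)  ≈⟨ ∙-congˡ (×-homo-+ h (i ℕ.∸ j) j) ⟨
      a ∙ (i ℕ.∸ j ℕ.+ j) · h      ≡⟨ ≡.cong (λ k → a ∙ k · h) (ℕ.m∸n+n≡m j≤i) ⟩
      a ∙ i · h                    ≈⟨ ∙-congˡ x≈ig ⟨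
      a ∙ _                        ≈⟨ ax≈y ⟩
      _                            ≈⟨ y≈jg ⟩
      j · h                        ≈⟨ identityˡ _ ⟨
      ε ∙ j · h                    ∎)
  ... | no j≰i = extend P {k = j ℕ.∸ i} (ℕ.m<n⇒0<n∸m i<j)
                   (ℕ.≤-trans (ℕ.m∸n≤m j i) (ℕ.m≤n⇒m≤1+n j≤s)) a≈[j∸i]g zf
    where
    open Progression P renaming (base to h)
    i<j = ℕ.≰⇒> j≰i
    a≈[j∸i]g : a ≈ (j ℕ.∸ i) · h
    a≈[j∸i]g = cancelʳ (i · h) _ _ (begin
      a ∙ i · h                ≈⟨ ∙-congˡ x≈ig ⟨
      a ∙ _                    ≈⟨ ax≈y ⟩
      _                        ≈⟨ y≈jg ⟩
      j · h                    ≡⟨ ≡.cong (_· h) (ℕ.m∸n+n≡m (ℕ.<⇒≤ i<j)) ⟨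
      (j ℕ.∸ i ℕ.+ i) · h      ≈⟨ ×-homo-+ h (j ℕ.∸ i) i ⟩
      (j ℕ.∸ i) · h ∙ i · h    ∎)

  -- Every term enters by `extend` with coefficient 1; the equation for the base is carried along so
  -- that the next term can be recognised as `1 · base`.
  constant-progression : ∀ {S} → All (g ≈_) S → ZeroFree S → ∃[ P ] Progression.base {S} P ≡ g
  constant-progression {g} [] _ = record
    { multiples = []
    ; nonzero   = λ 1≤j j≤0 → contradiction (ℕ.≤-trans 1≤j j≤0) λ ()
    ; covers    = λ { ℕ.z≤n → empty refl }
    } , ≡.refl
  constant-progression (g≈a ∷ all) zf with P , ≡.refl ← constant-progression all (proj₂ zf) =
    extend P {k = 1} ℕ.≤-refl (ℕ.s≤s ℕ.z≤n) (trans (sym g≈a) (sym (×-homo-1 _))) zf , ≡.refl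

  -- Terms whose deletion loses only the total.

  -- Together with `total∉`, this says that the sums of `S` are those of `a ∷ S` except the total.
  Tight : A → List A → Set (c ⊔ ℓ)
  Tight a S = ∀ {x} → SubsetSum (a ∷ S) x → x ≉ total (a ∷ S) → ¬ ¬ SubsetSum S x

  -- A lost sum other than the total would, with the total and `k` sums of `S`, give `2 + k`
  -- distinct sums of `a ∷ S`.
  tight : ∀ {k} → ZeroFree (a ∷ S) → ¬ AtLeast (2 ℕ.+ k) (SubsetSum (a ∷ S)) →
          AtLeast k (SubsetSum S) → Tight a S
  tight {a} {S} {k} zf few (xs , len , distinct , all) {x} s x≉σ x∉ =
    few (x ∷ total (a ∷ S) ∷ xs , ≡.cong (2 ℕ.+_) len ,
         (x≉σ ∷ All.map (avoids x∉) all) ∷ All.map (avoids (total∉ zf)) all ∷ distinct ,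
         s ∷ SubsetSum-total (a ∷ S) ∷ All.map skip all)
    where
    avoids : ∀ {y z} → ¬ SubsetSum S y → SubsetSum S z → y ≉ z
    avoids y∉ t y≈z = y∉ (SubsetSum-resp (sym y≈z) t)

  -- The reflection of `Tight` under `complement`: z = σ - x differs from σ, so it is a sum of `S`,
  -- and its complement within `S` is x - a.
  tight-subtract : Tight a S → SubsetSum (a ∷ S) x → x ≉ ε → ¬ ¬ (∃[ y ] SubsetSum S y × a ∙ y ≈ x)
  tight-subtract {a} {S} {x} tgt s x≉ε k with z , t , e ← complement s = tgt t z≉σ λ t′ →
    let y , u , e′ = complement t′ in k (y , u , cancelˡ z _ _ (begin
      z ∙ (a ∙ y)    ≈⟨ x∙y∙z≈y∙x∙z z a y ⟩
      a ∙ (z ∙ y)    ≈⟨ ∙-congˡ e′ ⟩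
      total (a ∷ S)  ≈⟨ e ⟨
      x ∙ z          ≈⟨ comm x z ⟩
      z ∙ x          ∎))
    where
    z≉σ : z ≉ total (a ∷ S)
    z≉σ z≈σ = x≉ε (cancelʳ z _ _ (trans e (trans (sym z≈σ) (sym (identityˡ z)))))

  -- With X = X(a ∷ b ∷ S): a ∈ X gives a - b ∈ X(a ∷ S) ⊆ X, so -b ∈ X(b ∷ S), and both
  -- X(b ∷ S) and X(a ∷ S) are X without the total; hence -b ∈ X(a ∷ S).
  tight-equal : ∀ {a b S} → ZeroFree (a ∷ b ∷ S) → Tight a (b ∷ S) → Tight b (a ∷ S) → ¬ a ≉ b
  tight-equal {a} {b} {S} zf tgtᵃ tgtᵇ a≉b =
    tight-subtract tgtᵇ (swap⁺ (take (SubsetSum-ε _) (identityʳ a))) a≉ε λ (x , s , bx≈a) →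
    tight-subtract tgtᵃ (swap⁺ (skip s))
      (λ x≈ε → a≉b (trans (sym bx≈a) (trans (∙-congˡ x≈ε) (identityʳ b)))) λ (y , t , ay≈x) →
    tgtᵇ (swap⁺ (skip t))
      (λ y≈σ → total∉ zf (SubsetSum-resp (trans y≈σ (x∙y∙z≈y∙x∙z b a _)) t)) λ t′ →
    proj₁ (ZeroFree-↭ a↔b zf) t′ (cancelˡ a _ _ (begin
      a ∙ (b ∙ y)  ≈⟨ x∙y∙z≈y∙x∙z a b y ⟩
      b ∙ (a ∙ y)  ≈⟨ ∙-congˡ ay≈x ⟩
      b ∙ x        ≈⟨ bx≈a ⟩
      a            ≈⟨ identityʳ a ⟨
      a ∙ ε        ∎))
    where
    a↔b : ∀ {a b} → a ∷ b ∷ S ↭ b ∷ a ∷ S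
    a↔b = Perm.swap _ _ Perm.refl

    swap⁺ : ∀ {a b x} → SubsetSum (a ∷ b ∷ S) x → SubsetSum (b ∷ a ∷ S) x
    swap⁺ = SubsetSum-↭ a↔b

    a≉ε : a ≉ ε
    a≉ε a≈ε = proj₁ zf (SubsetSum-ε _) (trans (identityʳ a) a≈ε)

  -- Savchev and Chen's theorem.
  few-sums⇒progression : Decidable _≈_ → ∀ k S → length S ≡ k → ZeroFree S →
                         ¬ AtLeast (k ℕ.+ k) (SubsetSum S) → ¬ ¬ Progression S
  few-sums⇒progression _≟_ _ [] _ zf _ np = np (proj₁ (constant-progression {ε} [] zf))
  few-sums⇒progression _≟_ ℕ.zero (_ ∷ _) ()
  few-sums⇒progression _≟_ (ℕ.suc k) S₀@(a ∷ S) len zf few np =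
    -- Under `np` all terms turn out to equal `a`, and then the sequence is a progression with base
    -- `a` after all.
    np (proj₁ (constant-progression (refl ∷ All.tabulate a≈) zf))
    where
    few′ : ∀ {T} → S₀ ↭ T → ¬ AtLeast (2 ℕ.+ (k ℕ.+ k)) (SubsetSum T)
    few′ p many′ =
      few (≡.subst (λ l → AtLeast l (SubsetSum S₀)) (≡.sym (≡.cong ℕ.suc (ℕ.+-suc k k)))
             (AtLeast-map (SubsetSum-↭ (↭-sym p)) many′))

    -- Otherwise `R` is a progression by induction. An overlap of its sums with their translates by
    -- `c` would extend it to `S₀`, against `np`; without overlap, the k + 1 sums of `R` double to
    -- 2k + 2, against `few`.
    many : ∀ {c R} → S₀ ↭ c ∷ R → ¬ ¬ AtLeast (k ℕ.+ k) (SubsetSum R)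
    many {c} {R} p ¬many =
      few-sums⇒progression _≟_ k R len′ (proj₂ zf′) ¬many λ P →
      few (AtLeast-map (SubsetSum-↭ (↭-sym p)) (disjoint-translate (ℕ.suc k)
        (λ s t cx≈y → np (Progression-↭ (↭-sym p) (extend-overlap P zf′ s t cx≈y)))
        (≡.subst (λ l → AtLeast (ℕ.suc l) (SubsetSum R)) len′
           (length<∣SubsetSums∣ R (proj₂ zf′)))))
      where
      zf′ = ZeroFree-↭ p zf
      len′ = ℕ.suc-injective (≡.trans (≡.sym (↭-length p)) len)

    a≈ : ∀ {b} → b ∈ S → a ≈ b
    a≈ {b} b∈S with R , p ← ∈⇒↭∷ b∈S = decidable-stable (a ≟ b) λ a≉b →
      -- Both orders are required: `q` exposes the deletion of `a` and `r` the deletion of `b`.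
      let q = Perm.prep a p
          r = Perm.trans q (Perm.swap a b Perm.refl)
      in many q λ mᵃ → many r λ mᵇ →
         tight-equal (ZeroFree-↭ q zf) (tight (ZeroFree-↭ q zf) (few′ q) mᵃ)
                     (tight (ZeroFree-↭ r zf) (few′ r) mᵇ) a≉b

-- The integers modulo `n`.

-- Carried by ℕ under congruence, so that sums stay unreduced as in `subSum` and multiples are
-- ordinary products. Negation is multiplication by n - 1.
residues : ∀ n → .{{NonZero n}} → AbelianGroup 0ℓ 0ℓ
residues n = record
  { Carrier = ℕ
  ; _≈_     = _≡_ on (_% n)
  ; _∙_     = ℕ._+_
  ; ε       = 0
  ; _⁻¹     = ℕ.pred n ℕ.*_
  ; isAbelianGroup = record
    { isGroup = record
      { isMonoid = record
        { isSemigroup = record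
          { isMagma = record
            { isEquivalence = On.isEquivalence (_% n) ≡.isEquivalence
            ; ∙-cong        = λ {a} {b} {x} {y} → +-cong-% a b x y
            }
          ; assoc = λ a b x → %-congˡ (ℕ.+-assoc a b x)
          }
        ; identity = (λ _ → ≡.refl) , %-congˡ ∘ ℕ.+-identityʳ
        }
      ; inverse = (λ a → ≡.trans (%-congˡ (ℕ.+-comm (ℕ.pred n ℕ.* a) a)) (a+[n-1]a≡0 a)) , a+[n-1]a≡0
      ; ⁻¹-cong = λ {a} {b} → *-cong-% a b
      }
    ; comm = λ a b → %-congˡ (ℕ.+-comm a b)
    }
  }
  where
  open ≡.≡-Reasoning

  +-cong-% : ∀ a b x y → a % n ≡ b % n → x % n ≡ y % n → (a ℕ.+ x) % n ≡ (b ℕ.+ y) % n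
  +-cong-% a b x y e e′ = begin
    (a ℕ.+ x) % n          ≡⟨ %-distribˡ-+ a x n ⟩
    (a % n ℕ.+ x % n) % n  ≡⟨ %-congˡ (≡.cong₂ ℕ._+_ e e′) ⟩
    (b % n ℕ.+ y % n) % n  ≡⟨ %-distribˡ-+ b y n ⟨
    (b ℕ.+ y) % n          ∎

  *-cong-% : ∀ a b → a % n ≡ b % n → (ℕ.pred n ℕ.* a) % n ≡ (ℕ.pred n ℕ.* b) % n
  *-cong-% a b e = begin
    (ℕ.pred n ℕ.* a) % n              ≡⟨ %-distribˡ-* (ℕ.pred n) a n ⟩
    ((ℕ.pred n % n) ℕ.* (a % n)) % n  ≡⟨ %-congˡ (≡.cong ((ℕ.pred n % n) ℕ.*_) e) ⟩
    ((ℕ.pred n % n) ℕ.* (b % n)) % n  ≡⟨ %-distribˡ-* (ℕ.pred n) b n ⟨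
    (ℕ.pred n ℕ.* b) % n              ∎

  a+[n-1]a≡0 : ∀ a → (a ℕ.+ ℕ.pred n ℕ.* a) % n ≡ 0 % n
  a+[n-1]a≡0 a = begin
    (a ℕ.+ ℕ.pred n ℕ.* a) % n   ≡⟨ %-congˡ (≡.cong (ℕ._* a) (ℕ.suc-pred n)) ⟩
    (n ℕ.* a) % n                ≡⟨ n∣m⇒m%n≡0 (n ℕ.* a) n (m∣m*n a) ⟩
    0                            ≡⟨ n∣m⇒m%n≡0 0 n (n ∣0) ⟨
    0 % n                        ∎

AllPairs-lookup : ∀ {a r} {A : Set a} {R : A → A → Set r} {xs} → AllPairs R xs →
                  ∀ {i j} → i Fin.< j → R (lookup xs i) (lookup xs j)
AllPairs-lookup (x∼xs ∷ _) {Fin.zero}  {Fin.suc j} _ = All.lookup x∼xs (∈-lookup j)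
AllPairs-lookup (_ ∷ pxs)  {Fin.suc i} {Fin.suc j} (ℕ.s≤s i<j) = AllPairs-lookup pxs i<j

residues-finite : ∀ {n} .{{_ : NonZero n}} {k p} {P : ℕ → Set p} →
                  n ℕ.< k → ¬ ZeroSumFreeSequences.AtLeast (residues n) k P
residues-finite {n} n<k (xs , ≡.refl , distinct , _)
  with i , j , i<j , eq ← pigeonhole n<k (λ i → lookup xs i mod n) =
  AllPairs-lookup distinct i<j (fromℕ<-injective _ _ _ _ eq)

terms : ∀ {n ℓ} → Vec (Fin n) ℓ → List ℕ
terms = map toℕ ∘ toList

length-terms : ∀ {n ℓ} (S : Vec (Fin n) ℓ) → length (terms S) ≡ ℓ
length-terms S = ≡.trans (length-map toℕ (toList S)) (length-toList S)

-- Progressions in the cyclic group.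

module _ {n : ℕ} .{{_ : NonZero n}} where

  open AbelianGroup (residues n) using (_≈_; ε; monoid; sym; trans; ∙-congˡ)
  open Mult monoid renaming (_×_ to _·_)
  open ZeroSumFreeSequences (residues n)

  ·≡* : ∀ k g → k · g ≡ k ℕ.* g
  ·≡* ℕ.zero    g = ≡.refl
  ·≡* (ℕ.suc k) g = ≡.cong (g ℕ.+_) (·≡* k g)

  ∣⇒≈0 : ∀ {x} → n ∣ x → x ≈ 0
  ∣⇒≈0 {x} n∣x = ≡.trans (n∣m⇒m%n≡0 x n n∣x) (≡.sym (n∣m⇒m%n≡0 0 n (n ∣0)))

  ≈0⇒∣ : ∀ {x} → x ≈ 0 → n ∣ x
  ≈0⇒∣ {x} x≈0 = m%n≡0⇒n∣m x n (≡.trans x≈0 (n∣m⇒m%n≡0 0 n (n ∣0)))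

  SubsetSum⇒subSum : ∀ {ℓ x} (S : Vec (Fin n) ℓ) → SubsetSum (terms S) x → ∃[ I ] subSum S I ≈ x
  SubsetSum⇒subSum []      (empty x≈0) = [] , sym x≈0
  SubsetSum⇒subSum (a ∷ S) (skip s) with I , e ← SubsetSum⇒subSum S s = outside ∷ I , e
  SubsetSum⇒subSum (a ∷ S) (take {y = y} s e) with I , e′ ← SubsetSum⇒subSum S s =
    inside ∷ I , trans (∙-congˡ {toℕ a} {subSum S I} {y} e′) e

  ZeroSumFree⇒ZeroFree : ∀ {ℓ} (S : Vec (Fin n) ℓ) → ZeroSumFree S → ZeroFree (terms S)
  ZeroSumFree⇒ZeroFree []      _  = tt
  ZeroSumFree⇒ZeroFree (a ∷ S) zf = a∙x≉0 , ZeroSumFree⇒ZeroFree S zf′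
    where
    a∙x≉0 : ∀ {x} → SubsetSum (terms S) x → ¬ (toℕ a ℕ.+ x ≈ 0)
    a∙x≉0 {x} s e with I , e′ ← SubsetSum⇒subSum S s =
      zf (inside ∷ I) (Fin.zero , here) (≈0⇒∣ (trans (∙-congˡ {toℕ a} {subSum S I} {x} e′) e))

    zf′ : ZeroSumFree S
    zf′ I (i , i∈I) = zf (outside ∷ I) (Fin.suc i , there i∈I)

  -- If e = gcd(base, n) ≥ 2, then q = n / e annihilates the base, while q ≤ n/2 < `length S` ≤
  -- `weight`, against `nonzero`.
  base-coprime : ∀ {S} (P : Progression S) → n ℕ.< length S ℕ.+ length S → Coprime (Progression.base P) n
  base-coprime {S} P n<2ℓ with gcd (Progression.base P) n in eq
  ... | ℕ.zero = contradiction (gcd[m,n]≡0⇒n≡0 (Progression.base P) eq) (ℕ.≢-nonZero⁻¹ n)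
  ... | 1 = gcd≡1⇒coprime {Progression.base P} eq
  ... | e@(ℕ.suc (ℕ.suc _)) = contradiction (∣⇒≈0 n∣qg) (nonzero 1≤q q≤s)
    where
    open Progression P
    e∣n : e ∣ n
    e∣n = ≡.subst (_∣ n) eq (gcd[m,n]∣n base n)
    q = n / e
    qe≡n : q ℕ.* e ≡ n
    qe≡n = m/n*n≡m e∣n
    1≤q : 1 ℕ.≤ q
    1≤q = m≥n⇒m/n>0 (∣⇒≤ e∣n)
    n∣qg : n ∣ q · base
    n∣qg = ≡.subst₂ _∣_ qe≡n (≡.sym (·≡* q base))
      (*-monoʳ-∣ q (≡.subst (_∣ base) eq (gcd[m,n]∣m base n)))
    q≤s : q ℕ.≤ weight
    q≤s = ℕ.≤-trans (ℕ.≮⇒≥ λ ℓ<q → ℕ.<-irrefl ≡.refl (begin-strict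
      n                        <⟨ n<2ℓ ⟩
      length S ℕ.+ length S    ≤⟨ ℕ.+-mono-≤ (ℕ.<⇒≤ ℓ<q) (ℕ.<⇒≤ ℓ<q) ⟩
      q ℕ.+ q                  ≡⟨ ≡.cong (q ℕ.+_) (ℕ.+-identityʳ q) ⟨
      2 ℕ.* q                  ≡⟨ ℕ.*-comm 2 q ⟩
      q ℕ.* 2                  ≤⟨ ℕ.*-monoʳ-≤ q (ℕ.s≤s (ℕ.s≤s ℕ.z≤n)) ⟩
      q ℕ.* e                  ≡⟨ qe≡n ⟩
      n                        ∎)) (length≤weight multiples)
      where open ℕ.≤-Reasoning

  -- The gcd divides n and a, hence xg; being coprime to g, it divides x. Thus `a` has order at
  -- least n/x and adds at most x/n to the cross number.
  gcd≤coefficient : ∀ {a g x} → Coprime g n → 1 ℕ.≤ x → a ≈ x · g → gcd a n ℕ.≤ x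
  gcd≤coefficient {a} {g} {x@(ℕ.suc _)} g⊥n _ a≈xg = ∣⇒≤ (coprime-divisor d⊥g d∣gx)
    where
    d∣n = gcd[m,n]∣n a n
    d⊥g : Coprime (gcd a n) g
    d⊥g (i∣d , i∣g) = g⊥n (i∣g , ∣-trans i∣d d∣n)
    d∣gx : gcd a n ∣ g ℕ.* x
    d∣gx = ≡.subst (gcd a n ∣_) (≡.trans (·≡* x g) (ℕ.*-comm x g))
      (∣n∣m%n⇒∣m d∣n (≡.subst (gcd a n ∣_) a≈xg (%-presˡ-∣ (gcd[m,n]∣m a n) d∣n)))

  -- Otherwise `nonzero` would apply to the multiple `n · base`, which vanishes.
  weight<n : ∀ {S} (P : Progression S) → Progression.weight P ℕ.< n
  weight<n P = ℕ.≰⇒> λ n≤s →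
    nonzero (ℕ.>-nonZero⁻¹ n) n≤s (∣⇒≈0 (≡.subst (n ∣_) (≡.sym (·≡* n base)) (m∣m*n base)))
    where open Progression P

-- Fractions and the upper bound for the cross number.

frac-≤ : ∀ a b c d .{{_ : NonZero b}} .{{_ : NonZero d}} → a ℕ.* d ℕ.≤ c ℕ.* b →
         (+ a) ℚ./ b ℚ.≤ (+ c) ℚ./ d
frac-≤ a b@(ℕ.suc b-1) c d@(ℕ.suc d-1) ad≤cb = ℚ.toℚᵘ-cancel-≤ (begin
  ℚ.toℚᵘ ((+ a) ℚ./ b)  ≃⟨ ℚ.toℚᵘ-fromℚᵘ (mkℚᵘ (+ a) b-1) ⟩
  mkℚᵘ (+ a) b-1        ≤⟨ ℚᵘ.*≤* (≡.subst₂ ℤ._≤_ (ℤ.pos-* a d) (ℤ.pos-* c b) (ℤ.+≤+ ad≤cb)) ⟩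
  mkℚᵘ (+ c) d-1        ≃⟨ ℚ.toℚᵘ-fromℚᵘ (mkℚᵘ (+ c) d-1) ⟨
  ℚ.toℚᵘ ((+ c) ℚ./ d)  ∎)
  where open ℚᵘ.≤-Reasoning

frac-+ : ∀ a b d .{{_ : NonZero d}} → (+ a) ℚ./ d ℚ.+ (+ b) ℚ./ d ≡ (+ (a ℕ.+ b)) ℚ./ d
frac-+ a b d@(ℕ.suc d-1) = ℚ.toℚᵘ-injective (begin-equality
  ℚ.toℚᵘ ((+ a) ℚ./ d ℚ.+ (+ b) ℚ./ d)
    ≃⟨ ℚ.toℚᵘ-homo-+ ((+ a) ℚ./ d) ((+ b) ℚ./ d) ⟩
  ℚ.toℚᵘ ((+ a) ℚ./ d) ℚᵘ.+ ℚ.toℚᵘ ((+ b) ℚ./ d)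
    ≃⟨ ℚᵘ.+-cong (ℚ.toℚᵘ-fromℚᵘ (mkℚᵘ (+ a) d-1)) (ℚ.toℚᵘ-fromℚᵘ (mkℚᵘ (+ b) d-1)) ⟩
  mkℚᵘ (+ a) d-1 ℚᵘ.+ mkℚᵘ (+ b) d-1
    ≃⟨ ℚᵘ.*≡* (common (+ a) (+ b) (+ d)) ⟩
  mkℚᵘ (+ (a ℕ.+ b)) d-1
    ≃⟨ ℚ.toℚᵘ-fromℚᵘ (mkℚᵘ (+ (a ℕ.+ b)) d-1) ⟨
  ℚ.toℚᵘ ((+ (a ℕ.+ b)) ℚ./ d)
    ∎)
  where
  open ℚᵘ.≤-Reasoning
  common : ∀ x y z → (x ℤ.* z ℤ.+ y ℤ.* z) ℤ.* z ≡ (x ℤ.+ y) ℤ.* (z ℤ.* z)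
  common = solve-∀

recip-≤ : ∀ q x n .{{_ : NonZero n}} → n ℕ.≤ q ℕ.* x → recip q ℚ.≤ (+ x) ℚ./ n
recip-≤ ℕ.zero    x n n≤0  = contradiction (ℕ.n≤0⇒n≡0 n≤0) (ℕ.≢-nonZero⁻¹ n)
recip-≤ q@(ℕ.suc _) x n n≤qx =
  frac-≤ 1 q x n (≡.subst₂ ℕ._≤_ (≡.sym (ℕ.*-identityˡ n)) (ℕ.*-comm q x) n≤qx)

recip-ord-≤ : ∀ {n} .{{_ : NonZero n}} (a : Fin n) {x} → gcd (toℕ a) n ℕ.≤ x → recip (ord a) ℚ.≤ (+ x) ℚ./ n
recip-ord-≤ {n} a {x} d≤x with gcd (toℕ a) n in eq
... | ℕ.zero  = contradiction (gcd[m,n]≡0⇒n≡0 (toℕ a) eq) (ℕ.≢-nonZero⁻¹ n)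
... | d@(ℕ.suc _) = recip-≤ (n / d) x n
  (ℕ.≤-trans (ℕ.≤-reflexive (≡.sym (m/n*n≡m d∣n))) (ℕ.*-monoʳ-≤ (n / d) d≤x))
  where
  d∣n : d ∣ n
  d∣n = ≡.subst (_∣ n) eq (gcd[m,n]∣n (toℕ a) n)

crossNumber-≤ : ∀ {n} .{{_ : NonZero n}} {g s ℓ} → Coprime g n → (S : Vec (Fin n) ℓ) →
                ZeroSumFreeSequences.Multiples (residues n) g (terms S) s →
                crossNumber S ℚ.≤ (+ s) ℚ./ n
crossNumber-≤ {n} g⊥n [] ZeroSumFreeSequences.[] = frac-≤ 0 1 0 n ℕ.z≤n
crossNumber-≤ {n} g⊥n (a ∷ S) (ZeroSumFreeSequences.cons {w = w} {x = x} 1≤x a≈xg m) =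
  ≡.subst (crossNumber (a ∷ S) ℚ.≤_) (frac-+ x w n)
    (ℚ.+-mono-≤ (recip-ord-≤ a (gcd≤coefficient g⊥n 1≤x a≈xg)) (crossNumber-≤ g⊥n S m))

1≤frac⇒≤ : ∀ {a d} .{{_ : NonZero d}} → 1ℚ ℚ.≤ (+ a) ℚ./ d → d ℕ.≤ a
1≤frac⇒≤ {a} {d@(ℕ.suc d-1)} 1≤a/d
  with ℚᵘ.*≤* d≤a ← ℚᵘ.≤-respʳ-≃ (ℚ.toℚᵘ-fromℚᵘ (mkℚᵘ (+ a) d-1)) (ℚ.toℚᵘ-mono-≤ 1≤a/d) =
  ℤ.drop‿+≤+ (≡.subst₂ ℤ._≤_ (ℤ.*-identityˡ (+ d)) (ℤ.*-identityʳ (+ a)) d≤a)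

-- The conclusion is a negation, so the progression can be used although it is only known under
-- double negation.
long⇒1≰crossNumber : ∀ {n} .{{_ : NonZero n}} {ℓ} (S : Vec (Fin n) ℓ) → ZeroSumFree S → n ℕ.< ℓ ℕ.+ ℓ →
                     ¬ 1ℚ ℚ.≤ crossNumber S
long⇒1≰crossNumber {n} S zf n<2ℓ 1≤k =
  few-sums⇒progression (λ x y → x % n ℕ.≟ y % n) _ (terms S) (length-terms S)
    (ZeroSumFree⇒ZeroFree S zf) (residues-finite n<2ℓ) λ P →
  let base⊥n = base-coprime P (≡.subst (λ l → n ℕ.< l ℕ.+ l) (≡.sym (length-terms S)) n<2ℓ)
  in ℕ.<⇒≱ (weight<n P)
       (1≤frac⇒≤ (ℚ.≤-trans 1≤k (crossNumber-≤ base⊥n S (Progression.multiples P))))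
  where open ZeroSumFreeSequences (residues n)

-- `IsPrimePower` has positive exponents, so n = 1 is still allowed, with k* = 0. It is excluded
-- because every sum in the trivial group is zero.
long⇒1<n : ∀ {n} .{{_ : NonZero n}} {ℓ} (S : Vec (Fin n) ℓ) → ZeroSumFree S → n ℕ.< ℓ ℕ.+ ℓ → 1 ℕ.< n
long⇒1<n {1} (a ∷ S) zf _ = contradiction (1∣ subSum (a ∷ S) ⊤ₛ) (zf ⊤ₛ (Fin.zero , here))
long⇒1<n {ℕ.suc (ℕ.suc _)} _ _ _ = ℕ.s≤s (ℕ.s≤s ℕ.z≤n)

-- The lower bound for k*.

product-constant : ∀ {p ns} → All (p ≡_) ns → product ns ≡ p ^ length ns
product-constant []              = ≡.refl
product-constant {p} (≡.refl ∷ all) = ≡.cong (p ℕ.*_) (product-constant all)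

-- Compare the first prime of a factorisation with the others: if all agree, n is a power of it.
two-prime-divisors : ∀ {n} .{{_ : NonZero n}} → 1 ℕ.< n → ¬ IsPrimePower n →
                     ∃[ p ] ∃[ q ] p ≢ q × (Prime p × p ∣ n) × (Prime q × q ∣ n)
two-prime-divisors {n} 1<n ¬pp with factorise n
... | record { factors = [] ; isFactorisation = n≡1 } = contradiction 1<n (ℕ.<-irrefl (≡.sym n≡1))
... | record { factors = p ∷ ps ; isFactorisation = n≡Π ; factorsPrime = primes } with All.all? (p ℕ.≟_) ps
...   | yes constant = contradiction
          -- The exponent is `suc (length ps)`, the leading `p` being counted by the `suc` in
          -- `IsPrimePower`.
          (p , length ps , All.head primes , ≡.trans n≡Π (product-constant (≡.refl ∷ constant))) ¬pp
...   | no ¬constant with q , q∈ps , p≢q ← find (All.¬All⇒Any¬ (p ℕ.≟_) ps ¬constant) =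
          p , q , p≢q , prime-divisor (here ≡.refl) , prime-divisor (there q∈ps)
  where
  prime-divisor : ∀ {r} → r ∈ p ∷ ps → Prime r × r ∣ n
  prime-divisor r∈ = All.lookup primes r∈ , ≡.subst (_ ∣_) (≡.sym n≡Π) (∈⇒∣product r∈)

∈-primeDivisors : ∀ {n p} .{{_ : NonZero n}} → Prime p × p ∣ n → p ∈ primeDivisors n
∈-primeDivisors (pr , p∣n) =
  ∈-filter⁺ prime? (∈-filter⁺ (_∣? _) (∈-upTo⁺ (ℕ.s≤s (∣⇒≤ p∣n))) p∣n) pr

ppartAux-≥1 : ∀ f m p → 1 ℕ.≤ ppartAux f m p
ppartAux-≥1 ℕ.zero    m p = ℕ.≤-refl
ppartAux-≥1 (ℕ.suc f) m ℕ.zero = ℕ.≤-refl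
ppartAux-≥1 (ℕ.suc f) m p@(ℕ.suc _) with p ∣? m
... | yes _ = ℕ.*-mono-≤ {1} {p} (ℕ.s≤s ℕ.z≤n) (ppartAux-≥1 f (m / p) p)
... | no  _ = ℕ.≤-refl

-- The fuel `n` is positive, so one factor `p` is split off, and what remains is at least 1.
ppart-≥2 : ∀ {n p} .{{_ : NonZero n}} → Prime p → p ∣ n → 2 ℕ.≤ ppart n p
ppart-≥2 {n@(ℕ.suc f)} {p@(ℕ.suc _)} pr p∣n with p ∣? n
... | yes _   = ℕ.*-mono-≤ {2} {p} (ℕ.nonTrivial⇒n>1 p {{prime⇒nonTrivial pr}}) (ppartAux-≥1 f (n / p) p)
... | no  p∤n = contradiction p∣n p∤n
ppart-≥2 {p = ℕ.zero} pr _ = contradiction pr ¬prime[0]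

-- Applied with x = 2 to get summands of at least 1/2, and with x = 1 to see that all summands are
-- non-negative.
1-recip-≥ : ∀ x {k} → x ℕ.≤ k → .{{_ : NonZero x}} → 1ℚ ℚ.- (+ 1) ℚ./ x ℚ.≤ 1ℚ ℚ.- recip k
1-recip-≥ x {k@(ℕ.suc _)} x≤k =
  ℚ.+-monoʳ-≤ 1ℚ (ℚ.neg-antimono-≤ (frac-≤ 1 k 1 x (ℕ.*-monoʳ-≤ 1 x≤k)))
1-recip-≥ (ℕ.suc _) {ℕ.zero} ()

module _ {a} {A : Set a} (f : A → ℚ) (0≤f : ∀ x → 0ℚ ℚ.≤ f x) where

  sum : List A → ℚ
  sum xs = foldr ℚ._+_ 0ℚ (map f xs)

  0≤sum : ∀ xs → 0ℚ ℚ.≤ sum xs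
  0≤sum []       = ℚ.≤-refl
  0≤sum (x ∷ xs) = ℚ.+-mono-≤ (0≤f x) (0≤sum xs)

  sum-tail-≤ : ∀ x xs → sum xs ℚ.≤ sum (x ∷ xs)
  sum-tail-≤ x xs = ≡.subst (ℚ._≤ sum (x ∷ xs)) (ℚ.+-identityˡ (sum xs)) (ℚ.+-monoˡ-≤ (sum xs) (0≤f x))

  term≤sum : ∀ {x xs} → x ∈ xs → f x ℚ.≤ sum xs
  term≤sum {x} (here {xs = xs} ≡.refl) =
    ≡.subst (ℚ._≤ sum (x ∷ xs)) (ℚ.+-identityʳ (f x)) (ℚ.+-monoʳ-≤ (f x) (0≤sum xs))
  term≤sum (there {x = y} {xs = xs} x∈xs) = ℚ.≤-trans (term≤sum x∈xs) (sum-tail-≤ y xs)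

  -- Distinct elements occupy different positions, and the other summands are non-negative.
  two-terms≤sum : ∀ {x y xs} → x ≢ y → x ∈ xs → y ∈ xs → f x ℚ.+ f y ℚ.≤ sum xs
  two-terms≤sum x≢y (here ≡.refl) (here ≡.refl) = contradiction ≡.refl x≢y
  two-terms≤sum {x} x≢y (here ≡.refl) (there y∈xs) = ℚ.+-monoʳ-≤ (f x) (term≤sum y∈xs)
  two-terms≤sum {x} {y} x≢y (there {xs = xs} x∈xs) (here ≡.refl) =
    ≡.subst (ℚ._≤ sum (y ∷ xs)) (ℚ.+-comm (f y) (f x)) (ℚ.+-monoʳ-≤ (f y) (term≤sum x∈xs))
  two-terms≤sum x≢y (there {x = z} {xs = xs} x∈xs) (there y∈xs) =
    ℚ.≤-trans (two-terms≤sum x≢y x∈xs y∈xs) (sum-tail-≤ z xs)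

1≤kStar : ∀ {n} .{{_ : NonZero n}} → 1 ℕ.< n → ¬ IsPrimePower n → 1ℚ ℚ.≤ kStar n
1≤kStar {n} 1<n ¬pp with p , q , p≢q , p∣n , q∣n ← two-prime-divisors 1<n ¬pp =
  ℚ.≤-trans
    -- The left side `(1 - 1/2) + (1 - 1/2)` evaluates to `1ℚ`.
    (ℚ.+-mono-≤ (1-recip-≥ 2 (ppart-≥2 (proj₁ p∣n) (proj₂ p∣n)))
                (1-recip-≥ 2 (ppart-≥2 (proj₁ q∣n) (proj₂ q∣n))))
    (two-terms≤sum (λ r → 1ℚ ℚ.- recip (ppart n r)) (λ r → 1-recip-≥ 1 (ppartAux-≥1 n n r)) p≢q
      (∈-primeDivisors p∣n) (∈-primeDivisors q∣n))

-- The bound on the length.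

theorem7p2 : (n : ℕ) → .{{_ : NonZero n}} → ¬ IsPrimePower n →
    (ℓ : ℕ) (S : Vec (Fin n) ℓ) → ZeroSumFree S →
    kStar n Data.Rational.≤ crossNumber S → ℓ Data.Nat.≤ n / 2
theorem7p2 n ¬pp ℓ S zf k*≤k = ℕ.≮⇒≥ λ n/2<ℓ →
  -- The remainder of n modulo 2 is below 2, so n < 2(⌊n/2⌋ + 1) ≤ 2ℓ.
  let n<2ℓ = begin-strict
        n                    ≡⟨ m≡m%n+[m/n]*n n 2 ⟩
        n % 2 ℕ.+ n / 2 ℕ.* 2  <⟨ ℕ.+-monoˡ-< (n / 2 ℕ.* 2) (m%n<n n 2) ⟩
        ℕ.suc (n / 2) ℕ.* 2  ≤⟨ ℕ.*-monoˡ-≤ 2 n/2<ℓ ⟩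
        ℓ ℕ.* 2              ≡⟨ ℕ.*-comm ℓ 2 ⟩
        2 ℕ.* ℓ              ≡⟨ ≡.cong (ℓ ℕ.+_) (ℕ.+-identityʳ ℓ) ⟩
        ℓ ℕ.+ ℓ              ∎
  in long⇒1≰crossNumber S zf n<2ℓ (ℚ.≤-trans (1≤kStar (long⇒1<n S zf n<2ℓ) ¬pp) k*≤k)
  where open ℕ.≤-Reasoning
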